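{- Let $R$ be a relational type, possibly containing the type variable $X$ free, with $X\in^+ R$, and let $\gamma$ be an environment defined on the free type variables of $\mathrm{Rec}\,X.R$. Then for all terms $t_1,t_2$: $t_1\,\llbracket \mathrm{Rec}\,X.R \simeq [\mathrm{Rec}\,X.R/X]R\rrbracket_\gamma\,t_2$.
   Context: Terms are those of the pure untyped $\lambda$-calculus, up to $\alpha$-equivalence; $=_{\beta\eta}$ is $\beta\eta$-convertibility. Relational types: $R ::= X \mid R\to R' \mid \forall X.R \mid R^{\cup} \mid R\cdot R' \mid t$ (last form: promotion of a term); $[R/X]R'$ is capture-avoiding substitution. A relation $r$ on terms is $\beta\eta$-closed if $t_1\,r\,t_2$, $t_1'=_{\beta\eta}t_1$, $t_2'=_{\beta\eta}t_2$ imply $t_1'\,r\,t_2'$; $\mathcal{R}$ is the set of such relations; environments $\gamma$ map finitely many type variables to $\mathcal{R}$. Interpretation: $\llbracket X\rrbracket_\gamma=\gamma(X)$; $t\,\llbracket R\to R'\rrbracket_\gamma\,t'$ iff for all $a,a'$ with $a\,\llbracket R\rrbracket_\gamma\,a'$, $t\,a\,\llbracket R'\rrbracket_\gamma\,t'\,a'$; $\llbracket \forall X.R\rrbracket_\gamma=\bigcap_{r\in\mathcal{R}}\llbracket R\rrbracket_{\gamma[X\mapsto r]}$; $t\,\llbracket R^\cup\rrbracket_\gamma\,t'$ iff $t'\,\llbracket R\rrbracket_\gamma\,t$; $t\,\llbracket R\cdot R'\rrbracket_\gamma\,t'$ iff $\exists t''$ with $t\,\llbracket R\rrbracket_\gamma\,t''$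 and $t''\,\llbracket R'\rrbracket_\gamma\,t'$; $\llbracket \hat t\rrbracket_\gamma=\{(t,t')\mid \hat t\,t=_{\beta\eta}t'\}$. Abbreviations: $I:=\lambda x.x$, $K:=\lambda x.\lambda y.x$; $t\bullet R:=t\cdot R\cdot t^\cup$; $R\subseteq R':=(K\,I)\bullet(R\to R')$; $R\Rightarrow R':=K\bullet(R\to R')$; $R\simeq R':=(R\subseteq R')\cdot(R'\subseteq R)$; $\mathrm{Rec}\,X.R := \forall X.(R\subseteq X)\Rightarrow X$. With polarities $p\in\{+,-\}$ and $\bar p$ the other, $X\in^pR$ is defined by: $X\in^+X$; $X\in^pY$ for type variables $Y\ne X$; $X\in^p(R\to R')$ iff $X\in^{\bar p}R$ and $X\in^pR'$; $X\in^p\forall Y.R$ iff $X\in^pR$; $X\in^p(R\cdot R')$ iff $X\in^pR$ and $X\in^pR'$; $X\in^pR^\cup$ iff $X\in^pR$; $X\in^p t$ for every promoted term. -}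

module Defs where

open import Axiom.ExcludedMiddle using (ExcludedMiddle)
open import Data.Bool.Base using (Bool; T)
open import Data.Fin.Base using (Fin; zero; suc)
open import Data.Nat.Base using (ℕ; zero; suc)
open import Data.Product.Base using (∃-syntax; _×_)
open import Data.Sign.Base using (Sign; opposite) renaming (+ to ⊕; - to ⊖)
open import Data.Vec.Functional using (Vector; _∷_)
open import Function.Bundles using (_⇔_; mk⇔)
open import Level using (0ℓ)
open import Relation.Binary.Construct.Closure.Equivalence using (EqClosure)
open import Relation.Binary.PropositionalEquality.Core using (_≢_)
open import Relation.Nullary.Decidable using (⌊_⌋; toWitness; fromWitness)

------------------------------------------------------------------------
-- Untyped λ-terms

-- Possibly open terms up to α-equivalence, as de Bruijn terms; unbound indices
-- are the (infinitely many) free term variables.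

infixl 9 _·_

data Λ : Set where
  var : ℕ → Λ
  lam : Λ → Λ
  _·_ : Λ → Λ → Λ

extᵣ : (ℕ → ℕ) → ℕ → ℕ
extᵣ ρ zero    = zero
extᵣ ρ (suc i) = suc (ρ i)

renameΛ : (ℕ → ℕ) → Λ → Λ
renameΛ ρ (var i) = var (ρ i)
renameΛ ρ (lam t) = lam (renameΛ (extᵣ ρ) t)
renameΛ ρ (t · u) = renameΛ ρ t · renameΛ ρ u

extₛ : (ℕ → Λ) → ℕ → Λ
extₛ σ zero    = var zero
extₛ σ (suc i) = renameΛ suc (σ i)

substΛ : (ℕ → Λ) → Λ → Λ
substΛ σ (var i) = σ i
substΛ σ (lam t) = lam (substΛ (extₛ σ) t)
substΛ σ (t · u) = substΛ σ t · substΛ σ u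

singleΛ : Λ → ℕ → Λ
singleΛ u zero    = u
singleΛ u (suc i) = var i

infix 4 _→βη_ _=βη_

data _→βη_ : Λ → Λ → Set where
  β   : ∀ {t u} → lam t · u →βη substΛ (singleΛ u) t
  η   : ∀ {t} → lam (renameΛ suc t · var zero) →βη t
  ξ   : ∀ {t t′} → t →βη t′ → lam t →βη lam t′
  ·ˡ  : ∀ {t t′ u} → t →βη t′ → t · u →βη t′ · u
  ·ʳ  : ∀ {t u u′} → u →βη u′ → t · u →βη t · u′

_=βη_ : Λ → Λ → Set
_=βη_ = EqClosure _→βη_

I K : Λ
I = lam (var 0)
K = lam (lam (var 1))

------------------------------------------------------------------------
-- Relational types

-- Ty n: relational types, up to α-equivalence, with free type variables among
-- n given ones. Type formers bind no term variables, so promoted terms are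
-- unaffected by type-level renaming and substitution.

infixr 6 _⟶_
infixr 7 _⨾_
infix  8 _˘

data Ty (n : ℕ) : Set where
  var : Fin n → Ty n
  _⟶_ : Ty n → Ty n → Ty n
  Π   : Ty (suc n) → Ty n
  _˘  : Ty n → Ty n
  _⨾_ : Ty n → Ty n → Ty n
  ⌜_⌝ : Λ → Ty n

extTyᵣ : ∀ {m n} → (Fin m → Fin n) → Fin (suc m) → Fin (suc n)
extTyᵣ ρ zero    = zero
extTyᵣ ρ (suc X) = suc (ρ X)

renameTy : ∀ {m n} → (Fin m → Fin n) → Ty m → Ty n
renameTy ρ (var X) = var (ρ X)
renameTy ρ (R ⟶ S) = renameTy ρ R ⟶ renameTy ρ S
renameTy ρ (Π R)   = Π (renameTy (extTyᵣ ρ) R)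
renameTy ρ (R ˘)   = renameTy ρ R ˘
renameTy ρ (R ⨾ S) = renameTy ρ R ⨾ renameTy ρ S
renameTy ρ ⌜ t ⌝   = ⌜ t ⌝

extTyₛ : ∀ {m n} → (Fin m → Ty n) → Fin (suc m) → Ty (suc n)
extTyₛ σ zero    = var zero
extTyₛ σ (suc X) = renameTy suc (σ X)

substTy : ∀ {m n} → (Fin m → Ty n) → Ty m → Ty n
substTy σ (var X) = σ X
substTy σ (R ⟶ S) = substTy σ R ⟶ substTy σ S
substTy σ (Π R)   = Π (substTy (extTyₛ σ) R)
substTy σ (R ˘)   = substTy σ R ˘
substTy σ (R ⨾ S) = substTy σ R ⨾ substTy σ S
substTy σ ⌜ t ⌝   = ⌜ t ⌝

singleTy : ∀ {n} → Ty n → Fin (suc n) → Ty n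
singleTy S zero    = S
singleTy S (suc X) = var X

-- [ S /X] R substitutes S for the most recently bound variable of R.
infix 9 [_/X]_

[_/X]_ : ∀ {n} → Ty n → Ty (suc n) → Ty n
[ S /X] R = substTy (singleTy S) R

infix  7 _●_
infixr 6 _⇒_
infix  5 _⊆_ _≃_

_●_ : ∀ {n} → Λ → Ty n → Ty n
t ● R = ⌜ t ⌝ ⨾ R ⨾ ⌜ t ⌝ ˘

_⊆_ : ∀ {n} → Ty n → Ty n → Ty n
R ⊆ S = (K · I) ● (R ⟶ S)

_⇒_ : ∀ {n} → Ty n → Ty n → Ty n
R ⇒ S = K ● (R ⟶ S)

_≃_ : ∀ {n} → Ty n → Ty n → Ty n
R ≃ S = (R ⊆ S) ⨾ (S ⊆ R)

Rec : ∀ {n} → Ty (suc n) → Ty n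
Rec R = Π ((R ⊆ var zero) ⇒ var zero)

infix 4 _∈⟨_⟩_

data _∈⟨_⟩_ {n : ℕ} (X : Fin n) : Sign → Ty n → Set where
  var-same : X ∈⟨ ⊕ ⟩ var X
  var-diff : ∀ {p Y} → Y ≢ X → X ∈⟨ p ⟩ var Y
  arrow    : ∀ {p R S} → X ∈⟨ opposite p ⟩ R → X ∈⟨ p ⟩ S → X ∈⟨ p ⟩ R ⟶ S
  forall′  : ∀ {p R} → suc X ∈⟨ p ⟩ R → X ∈⟨ p ⟩ Π R
  conv     : ∀ {p R} → X ∈⟨ p ⟩ R → X ∈⟨ p ⟩ R ˘
  comp     : ∀ {p R S} → X ∈⟨ p ⟩ R → X ∈⟨ p ⟩ S → X ∈⟨ p ⟩ R ⨾ S
  promote  : ∀ {p t} → X ∈⟨ p ⟩ ⌜ t ⌝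

------------------------------------------------------------------------
-- Impredicativity of the metatheory

-- The interpretation of ∀X.R quantifies over all βη-closed relations, and the
-- relation so defined must itself be one of them. Agda's universes are
-- predicative, so the power set of Λ × Λ is taken with respect to a small type
-- Ω of truth values naming every small proposition up to logical equivalence.

record Impredicativity : Set₁ where
  field
    Ω       : Set
    Holds   : Ω → Set
    code    : Set → Ω
    code-⇔  : ∀ P → Holds (code P) ⇔ P

-- Classically, Ω is just Bool, and Λ → Λ → Ω is the usual power set of Λ × Λ.

classical : ExcludedMiddle 0ℓ → Impredicativity
classical em = record
  { Ω      = Bool
  ; Holds  = T
  ; code   = λ P → ⌊ em {P} ⌋
  ; code-⇔ = λ P → mk⇔ (toWitness {a? = em {P}}) (fromWitness {a? = em {P}})
  }

------------------------------------------------------------------------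
-- Interpretation

module Semantics (impred : Impredicativity) where
  open Impredicativity impred

  record 𝓡 : Set where
    field
      rel    : Λ → Λ → Ω
      closed : ∀ {t₁ t₂ t₁′ t₂′} → Holds (rel t₁ t₂) →
               t₁′ =βη t₁ → t₂′ =βη t₂ → Holds (rel t₁′ t₂′)

  open 𝓡 public

  Env : ℕ → Set
  Env n = Vector 𝓡 n

  ⟦_⟧ : ∀ {n} → Ty n → Env n → Λ → Λ → Set
  ⟦ var X ⟧ γ t t′ = Holds (rel (γ X) t t′)
  ⟦ R ⟶ S ⟧ γ t t′ = ∀ a a′ → ⟦ R ⟧ γ a a′ → ⟦ S ⟧ γ (t · a) (t′ · a′)
  ⟦ Π R ⟧   γ t t′ = ∀ (r : 𝓡) → ⟦ R ⟧ (r ∷ γ) t t′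
  ⟦ R ˘ ⟧   γ t t′ = ⟦ R ⟧ γ t′ t
  ⟦ R ⨾ S ⟧ γ t t′ = ∃[ t″ ] ⟦ R ⟧ γ t t″ × ⟦ S ⟧ γ t″ t′
  ⟦ ⌜ u ⌝ ⟧ γ t t′ = u · t =βη t′

{-# OPTIONS --safe #-}

-- The internalised R ⊆ S and R ⇒ S hold of t and t′ exactly when ⟦R⟧ is
-- included in ⟦S⟧, respectively when ⟦S⟧ relates t and t′ as soon as ⟦R⟧ is
-- inhabited. Hence ⟦Rec R⟧ is the intersection of all βη-closed relations r
-- with F r ⊆ r, where F r = ⟦R⟧ (r ∷ γ). Positivity makes F monotone, so by
-- Knaster–Tarski this intersection is a fixed point of F, and F at ⟦Rec R⟧ is
-- the interpretation of [ Rec R /X] R.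

module Submission where

open import Data.Fin.Base using (Fin; zero; suc)
open import Data.Nat.Base using (ℕ; zero; suc)
open import Data.Product.Base using (∃-syntax; _×_; _,_)
open import Data.Sign.Base using (Sign; opposite) renaming (+ to ⊕; - to ⊖)
open import Data.Vec.Functional using (_∷_)
open import Function.Base using (id; _∘_; flip)
open import Function.Bundles using (module Equivalence)
open import Level using (0ℓ)
open import Relation.Binary.Core using (Rel) renaming (_⇒_ to _⊑_)
import Relation.Binary.Construct.Closure.Equivalence as Eq
open import Relation.Binary.PropositionalEquality.Core
  using (_≡_; _≢_; refl; cong; cong₂; subst)
open import Relation.Nullary.Negation.Core using (contradiction)
open import Defs

-- Conversion and the combinators `K` and `K · I`.

=βη-refl : ∀ {t} → t =βη t
=βη-refl = Eq.reflexive _→βη_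

=βη-trans : ∀ {t u v} → t =βη u → u =βη v → t =βη v
=βη-trans = Eq.transitive _→βη_

=βη-sym : ∀ {t u} → t =βη u → u =βη t
=βη-sym = Eq.symmetric _→βη_

·-congˡ : ∀ {t t′ u} → t =βη t′ → t · u =βη t′ · u
·-congˡ {u = u} = Eq.gmap (_· u) ·ˡ

·-congʳ : ∀ {t u u′} → u =βη u′ → t · u =βη t · u′
·-congʳ {t} = Eq.gmap (t ·_) ·ʳ

-- Contracting `K · t` weakens `t` under the remaining binder, and the next contraction must undo
-- this. General `σ` and `ρ` let the induction pass under `lam`.
substΛ-renameΛ-inverse : ∀ {σ ρ} → (∀ i → σ (ρ i) ≡ var i) →
                         ∀ t → substΛ σ (renameΛ ρ t) ≡ t
substΛ-renameΛ-inverse inv (var i) = inv i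
substΛ-renameΛ-inverse {σ} {ρ} inv (lam t) =
  cong lam (substΛ-renameΛ-inverse ext-inv t)
  where
  ext-inv : ∀ i → extₛ σ (extᵣ ρ i) ≡ var i
  ext-inv zero    = refl
  ext-inv (suc i) = cong (renameΛ suc) (inv i)
substΛ-renameΛ-inverse inv (t · u) =
  cong₂ _·_ (substΛ-renameΛ-inverse inv t) (substΛ-renameΛ-inverse inv u)

K-β : ∀ t u → K · t · u =βη t
K-β t u = =βη-trans (·-congˡ (Eq.return β))
  (subst (lam (renameΛ suc t) · u =βη_)
         (substΛ-renameΛ-inverse (λ _ → refl) t) (Eq.return β))

KI-β : ∀ t u → K · I · t · u =βη u
KI-β t u = =βη-trans (·-congˡ (K-β I t)) (Eq.return β)

-- Inclusions with a sign.

infix 4 _⊑⟨_⟩_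

-- The sign carries the direction of inclusion, so a single induction treats both polarities and the
-- domain of an arrow only flips the sign.
_⊑⟨_⟩_ : Rel Λ 0ℓ → Sign → Rel Λ 0ℓ → Set
P ⊑⟨ ⊕ ⟩ Q = P ⊑ Q
P ⊑⟨ ⊖ ⟩ Q = Q ⊑ P

⊑-refl : ∀ p {P} → P ⊑⟨ p ⟩ P
⊑-refl ⊕ = id
⊑-refl ⊖ = id

⊑-trans : ∀ p {P Q S} → P ⊑⟨ p ⟩ Q → Q ⊑⟨ p ⟩ S → P ⊑⟨ p ⟩ S
⊑-trans ⊕ f g = g ∘ f
⊑-trans ⊖ f g = f ∘ g

arrow-mono : ∀ p {P P′ Q Q′} → P ⊑⟨ opposite p ⟩ P′ → Q ⊑⟨ p ⟩ Q′ →
             (λ t t′ → ∀ a a′ → P a a′ → Q (t · a) (t′ · a′)) ⊑⟨ p ⟩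
             (λ t t′ → ∀ a a′ → P′ a a′ → Q′ (t · a) (t′ · a′))
arrow-mono ⊕ f g h a a′ = g ∘ h a a′ ∘ f
arrow-mono ⊖ f g h a a′ = g ∘ h a a′ ∘ f

⋂-mono : ∀ p {A : Set} {P Q : A → Rel Λ 0ℓ} → (∀ r → P r ⊑⟨ p ⟩ Q r) →
         (λ t t′ → ∀ r → P r t t′) ⊑⟨ p ⟩ (λ t t′ → ∀ r → Q r t t′)
⋂-mono ⊕ f h r = f r (h r)
⋂-mono ⊖ f h r = f r (h r)

flip-mono : ∀ p {P Q} → P ⊑⟨ p ⟩ Q → flip P ⊑⟨ p ⟩ flip Q
flip-mono ⊕ f = f
flip-mono ⊖ f = f

comp-mono : ∀ p {P P′ Q Q′} → P ⊑⟨ p ⟩ P′ → Q ⊑⟨ p ⟩ Q′ →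
            (λ t t′ → ∃[ t″ ] P t t″ × Q t″ t′) ⊑⟨ p ⟩
            (λ t t′ → ∃[ t″ ] P′ t t″ × Q′ t″ t′)
comp-mono ⊕ f g (t″ , x , y) = t″ , f x , g y
comp-mono ⊖ f g (t″ , x , y) = t″ , f x , g y

-- Closure, monotonicity and substitution.

module Interpretation (impred : Impredicativity) where
  open Semantics impred
  open Impredicativity impred

  ⟦⟧-closed : ∀ {n} (R : Ty n) {γ t₁ t₂ t₁′ t₂′} → ⟦ R ⟧ γ t₁ t₂ →
              t₁′ =βη t₁ → t₂′ =βη t₂ → ⟦ R ⟧ γ t₁′ t₂′
  ⟦⟧-closed (var X) {γ} h e₁ e₂ = closed (γ X) h e₁ e₂
  ⟦⟧-closed (R ⟶ S) h e₁ e₂ a a′ x =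
    ⟦⟧-closed S (h a a′ x) (·-congˡ e₁) (·-congˡ e₂)
  ⟦⟧-closed (Π R) h e₁ e₂ r = ⟦⟧-closed R (h r) e₁ e₂
  ⟦⟧-closed (R ˘) h e₁ e₂ = ⟦⟧-closed R h e₂ e₁
  ⟦⟧-closed (R ⨾ S) (t″ , x , y) e₁ e₂ =
    t″ , ⟦⟧-closed R x e₁ =βη-refl , ⟦⟧-closed S y =βη-refl e₂
  ⟦⟧-closed ⌜ u ⌝ h e₁ e₂ = =βη-trans (·-congʳ e₁) (=βη-trans h (=βη-sym e₂))

  -- Induction on the polarity derivation. Off `X` the environments agree exactly, since other
  -- variables may occur with either sign.
  ⟦⟧-mono : ∀ {n} {X : Fin n} {p R} → X ∈⟨ p ⟩ R → ∀ {γ γ′} →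
            ⟦ var X ⟧ γ ⊑ ⟦ var X ⟧ γ′ → (∀ {Y} → Y ≢ X → γ Y ≡ γ′ Y) →
            ⟦ R ⟧ γ ⊑⟨ p ⟩ ⟦ R ⟧ γ′
  ⟦⟧-mono var-same le off = le
  ⟦⟧-mono {p = p} (var-diff Y≢X) le off rewrite off Y≢X = ⊑-refl p
  ⟦⟧-mono {p = p} (arrow x y) le off =
    arrow-mono p (⟦⟧-mono x le off) (⟦⟧-mono y le off)
  ⟦⟧-mono {X = X} {p} (forall′ x) {γ} {γ′} le off =
    ⋂-mono p (λ r → ⟦⟧-mono x le (off-∷ r))
    where
    off-∷ : ∀ r {Y} → Y ≢ suc X → (r ∷ γ) Y ≡ (r ∷ γ′) Y
    off-∷ r {zero}  _  = refl
    off-∷ r {suc Y} ne = off (ne ∘ cong suc)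
  ⟦⟧-mono {p = p} (conv x) le off = flip-mono p (⟦⟧-mono x le off)
  ⟦⟧-mono {p = p} (comp x y) le off =
    comp-mono p (⟦⟧-mono x le off) (⟦⟧-mono y le off)
  ⟦⟧-mono {p = p} promote le off = ⊑-refl p

  -- Quantifying over the sign p in the next two lemmas makes each of them an
  -- equivalence.
  ⟦renameTy⟧ : ∀ p {m n} (R : Ty m) {ρ : Fin m → Fin n} {γ γ′} →
               (∀ X → γ (ρ X) ≡ γ′ X) → ⟦ renameTy ρ R ⟧ γ ⊑⟨ p ⟩ ⟦ R ⟧ γ′
  ⟦renameTy⟧ p (var X) eq rewrite eq X = ⊑-refl p
  ⟦renameTy⟧ p (R ⟶ S) eq =
    arrow-mono p (⟦renameTy⟧ (opposite p) R eq) (⟦renameTy⟧ p S eq)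
  ⟦renameTy⟧ p (Π R) {ρ} {γ} {γ′} eq = ⋂-mono p (λ r → ⟦renameTy⟧ p R (eq-∷ r))
    where
    eq-∷ : ∀ r X → (r ∷ γ) (extTyᵣ ρ X) ≡ (r ∷ γ′) X
    eq-∷ r zero    = refl
    eq-∷ r (suc X) = eq X
  ⟦renameTy⟧ p (R ˘) eq = flip-mono p (⟦renameTy⟧ p R eq)
  ⟦renameTy⟧ p (R ⨾ S) eq =
    comp-mono p (⟦renameTy⟧ p R eq) (⟦renameTy⟧ p S eq)
  ⟦renameTy⟧ p ⌜ u ⌝ eq = ⊑-refl p

  ⟦substTy⟧ : ∀ p {m n} (R : Ty m) {σ : Fin m → Ty n} {γ γ′} →
              (∀ q X → ⟦ σ X ⟧ γ ⊑⟨ q ⟩ ⟦ var X ⟧ γ′) →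
              ⟦ substTy σ R ⟧ γ ⊑⟨ p ⟩ ⟦ R ⟧ γ′
  ⟦substTy⟧ p (var X) h = h p X
  ⟦substTy⟧ p (R ⟶ S) h =
    arrow-mono p (⟦substTy⟧ (opposite p) R h) (⟦substTy⟧ p S h)
  ⟦substTy⟧ p (Π R) {σ} {γ} {γ′} h = ⋂-mono p (λ r → ⟦substTy⟧ p R (h-∷ r))
    where
    h-∷ : ∀ r q X → ⟦ extTyₛ σ X ⟧ (r ∷ γ) ⊑⟨ q ⟩ ⟦ var X ⟧ (r ∷ γ′)
    h-∷ r q zero    = ⊑-refl q
    h-∷ r q (suc X) = ⊑-trans q (⟦renameTy⟧ q (σ X) (λ _ → refl)) (h q X)
  ⟦substTy⟧ p (R ˘) h = flip-mono p (⟦substTy⟧ p R h)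
  ⟦substTy⟧ p (R ⨾ S) h = comp-mono p (⟦substTy⟧ p R h) (⟦substTy⟧ p S h)
  ⟦substTy⟧ p ⌜ u ⌝ h = ⊑-refl p

  -- Internalised inclusion and implication.

  module _ {n} {γ : Env n} where

    ●-intro : ∀ {u t t′} (R : Ty n) →
              ⟦ R ⟧ γ (u · t) (u · t′) → ⟦ u ● R ⟧ γ t t′
    -- The intermediate terms are `u · t` and `u · t′`.
    ●-intro R x = _ , =βη-refl , _ , x , =βη-refl

    ●-elim : ∀ {u t t′} (R : Ty n) →
             ⟦ u ● R ⟧ γ t t′ → ⟦ R ⟧ γ (u · t) (u · t′)
    ●-elim R (_ , e₁ , _ , x , e₂) = ⟦⟧-closed R x e₁ e₂

    -- `K · I · t · a` converts to `a`, so `t` and `t′` disappear from the arrow condition.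
    ⊆-intro : ∀ (R S : Ty n) {t t′} → ⟦ R ⟧ γ ⊑ ⟦ S ⟧ γ → ⟦ R ⊆ S ⟧ γ t t′
    ⊆-intro R S f = ●-intro (R ⟶ S)
      (λ a a′ x → ⟦⟧-closed S (f x) (KI-β _ a) (KI-β _ a′))

    ⊆-elim : ∀ (R S : Ty n) {t t′} → ⟦ R ⊆ S ⟧ γ t t′ → ⟦ R ⟧ γ ⊑ ⟦ S ⟧ γ
    ⊆-elim R S h {a} {a′} x = ⟦⟧-closed S (●-elim (R ⟶ S) h a a′ x)
      (=βη-sym (KI-β _ a)) (=βη-sym (KI-β _ a′))

    -- `K · t · a` converts to `t`, so here the arguments disappear instead.
    ⇒-intro : ∀ (R S : Ty n) {t t′} →
              (∀ {a a′} → ⟦ R ⟧ γ a a′ → ⟦ S ⟧ γ t t′) → ⟦ R ⇒ S ⟧ γ t t′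
    ⇒-intro R S f = ●-intro (R ⟶ S)
      (λ a a′ x → ⟦⟧-closed S (f x) (K-β _ a) (K-β _ a′))

    ⇒-elim : ∀ (R S : Ty n) {t t′ a a′} →
             ⟦ R ⇒ S ⟧ γ t t′ → ⟦ R ⟧ γ a a′ → ⟦ S ⟧ γ t t′
    ⇒-elim R S {a = a} {a′} h x = ⟦⟧-closed S (●-elim (R ⟶ S) h a a′ x)
      (=βη-sym (K-β _ a)) (=βη-sym (K-β _ a′))

  -- Impredicativity enters here: `code` brings an interpreted type into the range of the quantifier
  -- of `Π`.
  ⟦_⟧ᴿ : ∀ {n} → Ty n → Env n → 𝓡
  ⟦ R ⟧ᴿ γ = record
    { rel    = λ t t′ → code (⟦ R ⟧ γ t t′)
    ; closed = λ {t₁} {t₂} {t₁′} {t₂′} h e₁ e₂ →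
        Equivalence.from (code-⇔ (⟦ R ⟧ γ t₁′ t₂′))
          (⟦⟧-closed R (Equivalence.to (code-⇔ (⟦ R ⟧ γ t₁ t₂)) h) e₁ e₂)
    }

  module _ {n} (R : Ty n) {γ : Env n} where

    encode : ⟦ R ⟧ γ ⊑ ⟦ var zero ⟧ (⟦ R ⟧ᴿ γ ∷ γ)
    encode {t} {t′} = Equivalence.from (code-⇔ (⟦ R ⟧ γ t t′))

    decode : ⟦ var zero ⟧ (⟦ R ⟧ᴿ γ ∷ γ) ⊑ ⟦ R ⟧ γ
    decode {t} {t′} = Equivalence.to (code-⇔ (⟦ R ⟧ γ t t′))

  ⟦/X⟧ : ∀ p {n} (R : Ty (suc n)) (S : Ty n) {γ} →
         ⟦ [ S /X] R ⟧ γ ⊑⟨ p ⟩ ⟦ R ⟧ (⟦ S ⟧ᴿ γ ∷ γ)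
  ⟦/X⟧ p R S {γ} = ⟦substTy⟧ p R single
    where
    single : ∀ q X → ⟦ singleTy S X ⟧ γ ⊑⟨ q ⟩ ⟦ var X ⟧ (⟦ S ⟧ᴿ γ ∷ γ)
    single ⊕ zero    = encode S
    single ⊖ zero    = decode S
    single q (suc X) = ⊑-refl q

  -- `Rec R` as the least fixed point.

  module _ {n} (R : Ty (suc n)) {γ : Env n} where

    PreFixed : 𝓡 → Set
    PreFixed r = ⟦ R ⟧ (r ∷ γ) ⊑ ⟦ var zero ⟧ (r ∷ γ)

    Rec-intro : ∀ {t t′} → (∀ r → PreFixed r → Holds (rel r t t′)) →
                ⟦ Rec R ⟧ γ t t′
    Rec-intro f r = ⇒-intro (R ⊆ var zero) (var zero)
      (λ h → f r (⊆-elim R (var zero) h))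

    -- ⟦ R ⊆ X ⟧ does not depend on the two terms it relates, so any terms
    -- witness that it is inhabited.
    Rec-elim : ∀ r → PreFixed r → ⟦ Rec R ⟧ γ ⊑ ⟦ var zero ⟧ (r ∷ γ)
    Rec-elim r pre h = ⇒-elim (R ⊆ var zero) (var zero) (h r)
      (⊆-intro R (var zero) {I} {I} pre)

    module _ (pos : zero ∈⟨ ⊕ ⟩ R) where

      F-mono : ∀ {r s} → ⟦ var zero ⟧ (r ∷ γ) ⊑ ⟦ var zero ⟧ (s ∷ γ) →
               ⟦ R ⟧ (r ∷ γ) ⊑ ⟦ R ⟧ (s ∷ γ)
      F-mono {r} {s} le = ⟦⟧-mono pos le off
        where
        off : ∀ {Y} → Y ≢ zero → (r ∷ γ) Y ≡ (s ∷ γ) Y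
        off {zero}  ne = contradiction refl ne
        off {suc Y} _  = refl

      -- For each prefixed `r`, `Rec R` lies below `r`, so F of it lies below F `r`, hence below
      -- `r`.
      Rec-fold : ⟦ [ Rec R /X] R ⟧ γ ⊑ ⟦ Rec R ⟧ γ
      Rec-fold x = Rec-intro λ r pre →
        pre (F-mono (λ y → Rec-elim r pre (decode (Rec R) y))
                    (⟦/X⟧ ⊕ R (Rec R) x))

      -- Applying F to `Rec-fold` shows that `F-Rec` is itself prefixed, so `Rec R` lies below it.
      Rec-unfold : ⟦ Rec R ⟧ γ ⊑ ⟦ [ Rec R /X] R ⟧ γ
      Rec-unfold x = decode F-Rec (Rec-elim (⟦ F-Rec ⟧ᴿ γ) pre x)
        where
        F-Rec = [ Rec R /X] R

        pre : PreFixed (⟦ F-Rec ⟧ᴿ γ)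
        pre y = encode F-Rec (⟦/X⟧ ⊖ R (Rec R)
          (F-mono (λ z → encode (Rec R) (Rec-fold (decode F-Rec z))) y))

mainTheorem3 : (impred : Impredicativity) → let open Semantics impred in
    ∀ (n : ℕ) (R : Ty (suc n)) → zero ∈⟨ ⊕ ⟩ R →
    ∀ (γ : Env n) (t₁ t₂ : Λ) → ⟦ Rec R ≃ [ Rec R /X] R ⟧ γ t₁ t₂
mainTheorem3 impred n R pos γ t₁ t₂ =
  -- Each internal inclusion holds between arbitrary terms, so `t₁` can serve as the middle term.
  t₁ , ⊆-intro (Rec R) ([ Rec R /X] R) (Rec-unfold R pos)
     , ⊆-intro ([ Rec R /X] R) (Rec R) (Rec-fold R pos)
  where open Interpretation impred
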